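{- Let $S_{10}=(s_0,s_1,\dots,s_{47})$ be the sequence $$\begin{aligned}\bigl(&4^2,(-8)^2,(-4)^2,6^4,8^2,(-6)^4,4^2,(-8)^2,(-4)^2,8^2,4^2,8^2,\\&(-4)^2,(-8)^2,4^2,(-8)^2,(-4)^2,8^2,4^2,8^2,(-4)^2,(-8)^2\bigr),\end{aligned}$$ where $u^k$ stands for $k$ consecutive entries equal to $u$. Let $\varphi_{10}:\mathbb{N}\to\mathbb{N}$ be the function defined as follows. The values $\varphi_{10}(0),\varphi_{10}(1),\dots,\varphi_{10}(65)$ are, in order (ten per row), $$\begin{array}{l}12,13,10,11,8,9,16,17,4,5,\\ 2,3,0,1,24,25,6,7,22,23,\\ 26,27,18,19,14,15,20,21,32,33,\\ 36,37,28,29,38,39,30,31,34,35,\\ 48,49,46,47,50,51,42,43,40,41,\\ 44,45,56,57,62,63,52,53,64,65,\\ 68,69,54,55,58,59,\end{array}$$ and for $x\ge 66$, $$\varphi_{10}(x)=x+s_{x-66},$$ where the index $x-66$ is taken modulo $48$. Then, for all nonnegative integers $a,b$, the Halve Nim position $a^1b^1{10}^1$ is a $\mathcal{P}$-position if and only if $b=\varphi_{10}(a)$.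
   Context: $\mathbb{N}$ is the set of nonnegative integers. Halve Nim is a two-player game played on finitely many piles of coins; players alternate moves and a player who cannot move loses. A move is one of: (i) choose one pile and remove at least one coin from it; (ii) halve the game: simultaneously replace every pile of $m$ coins by a pile of $\lfloor m/2\rfloor$ coins. When there are no coins left, no move is available (halving requires at least one coin to be present). A position is a $\mathcal{P}$-position if the player who is not about to move has a winning strategy (equivalently, every move from it leads to an $\mathcal{N}$-position), and an $\mathcal{N}$-position if the player about to move has a winning strategy. $a^1b^1c^1$ denotes the position with three piles of sizes $a$, $b$, $c$ (a pile of size $0$ is an empty pile); in particular $a^1b^1{10}^1$ has piles of sizes $a$, $b$, $10$. -}

module Defs where

open import Data.Fin using (Fin; fromℕ<)
open import Data.Integer as ℤ using (ℤ; +_; -_; ∣_∣)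
open import Data.List as List using (List; length; _[_]∷=_)
open import Data.List.Relation.Unary.Any using (Any)
open import Data.Nat using (ℕ; _<_; _∸_; ⌊_/2⌋; _<?_)
open import Data.Nat.DivMod using (_mod_)
open import Data.Vec using (Vec; []; _∷_; _++_; replicate; lookup)
open import Relation.Nullary using (yes; no)

-- A position lists the pile sizes; empty piles may be listed.
Position : Set
Position = List ℕ

infix 4 _⟶_

data _⟶_ (ps : Position) : Position → Set where
  remove : (i : Fin (length ps)) {m : ℕ} → m < List.lookup ps i →
           ps ⟶ (ps [ i ]∷= m)
  halve  : Any (0 <_) ps → ps ⟶ List.map ⌊_/2⌋ ps

-- Elements are winning strategies for normal play: in 𝒩-position for the
-- player about to move, in 𝒫-position for the opponent.
data 𝒫-position (p : Position) : Set
data 𝒩-position (p : Position) : Set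

data 𝒫-position p where
  reply : (∀ {q} → p ⟶ q → 𝒩-position q) → 𝒫-position p

data 𝒩-position p where
  move : ∀ {q} → p ⟶ q → 𝒫-position q → 𝒩-position p

S₁₀ : Vec ℤ 48
S₁₀ =
  replicate 2 (+ 4) ++ replicate 2 (- + 8) ++ replicate 2 (- + 4) ++
  replicate 4 (+ 6) ++ replicate 2 (+ 8) ++ replicate 4 (- + 6) ++
  replicate 2 (+ 4) ++ replicate 2 (- + 8) ++ replicate 2 (- + 4) ++
  replicate 2 (+ 8) ++ replicate 2 (+ 4) ++ replicate 2 (+ 8) ++
  replicate 2 (- + 4) ++ replicate 2 (- + 8) ++ replicate 2 (+ 4) ++
  replicate 2 (- + 8) ++ replicate 2 (- + 4) ++ replicate 2 (+ 8) ++
  replicate 2 (+ 4) ++ replicate 2 (+ 8) ++ replicate 2 (- + 4) ++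
  replicate 2 (- + 8)

φ₁₀-initial : Vec ℕ 66
φ₁₀-initial =
  12 ∷ 13 ∷ 10 ∷ 11 ∷  8 ∷  9 ∷ 16 ∷ 17 ∷  4 ∷  5 ∷
   2 ∷  3 ∷  0 ∷  1 ∷ 24 ∷ 25 ∷  6 ∷  7 ∷ 22 ∷ 23 ∷
  26 ∷ 27 ∷ 18 ∷ 19 ∷ 14 ∷ 15 ∷ 20 ∷ 21 ∷ 32 ∷ 33 ∷
  36 ∷ 37 ∷ 28 ∷ 29 ∷ 38 ∷ 39 ∷ 30 ∷ 31 ∷ 34 ∷ 35 ∷
  48 ∷ 49 ∷ 46 ∷ 47 ∷ 50 ∷ 51 ∷ 42 ∷ 43 ∷ 40 ∷ 41 ∷
  44 ∷ 45 ∷ 56 ∷ 57 ∷ 62 ∷ 63 ∷ 52 ∷ 53 ∷ 64 ∷ 65 ∷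
  68 ∷ 69 ∷ 54 ∷ 55 ∷ 58 ∷ 59 ∷ []

-- In the second case x ≥ 66 and every entry of S₁₀ is at least -8, so the
-- integer sum is positive and ∣_∣ only converts it back to ℕ.
φ₁₀ : ℕ → ℕ
φ₁₀ x with x <? 66
... | yes x<66 = lookup φ₁₀-initial (fromℕ< x<66)
... | no  _    = ∣ + x ℤ.+ lookup S₁₀ ((x ∸ 66) mod 48) ∣

{-# OPTIONS --safe #-}
module Submission where

-- For each c ≤ 10 and each a there is exactly one b such that (a, b, c) is a
-- 𝒫-position; call it Φ c a.  For c ≥ 4 it is eventually a + (periodic
-- offset).  For c ≤ 3 it is not: the offset pattern flips whenever a passes
-- some 7·2ᵏ, because halving feeds the pattern back into itself.  So Φ c a is
-- made to depend on a colour bit, the parity of ⌊log₂ (a / 28)⌋, which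
-- halving negates.  Apart from that bit everything is invariant under
-- a ↦ 48 + a, and since ∣ Φ c a - a ∣ ≤ 12 the defining property of the
-- 𝒫-positions is a finite check.

open import Defs
open import Data.Bool as Bool using (Bool; true; false; not)
open import Data.Bool.Properties using (not-involutive)
open import Data.Empty using (⊥; ⊥-elim)
open import Data.Fin as Fin using (Fin; fromℕ<)
open import Data.Fin.Properties as Fin using (fromℕ<-cong)
open import Data.Integer as ℤ using (ℤ; +_; -_; -[1+_]; ∣_∣)
open import Data.Integer.Properties using (⊖-≥)
open import Data.List as List using ([]; _∷_; length; _[_]∷=_)
open import Data.List.Relation.Unary.Any using (Any; here; there)
open import Data.Nat
open import Data.Nat.Divisibility using (_∣_; divides; _∣?_)
open import Data.Nat.DivMod
open import Data.Nat.GeneralisedArithmetic using (fold)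
open import Data.Nat.Induction using (Acc; acc; <-wellFounded; <-rec)
open import Data.Nat.ListAction using (sum)
open import Data.Nat.Logarithm using (⌊log₂_⌋; ⌊log₂⌊n/2⌋⌋≡⌊log₂n⌋∸1; ⌊log₂⌋-mono-≤)
open import Data.Nat.Properties
open import Data.Product using (∃; _×_; _,_)
open import Data.Sum using (_⊎_; inj₁; inj₂)
open import Data.Vec using (Vec; []; _∷_; lookup)
open import Function.Bundles using (_⇔_; mk⇔)
open import Relation.Binary.Definitions using (tri<; tri≈; tri>)
open import Relation.Binary.PropositionalEquality
open import Relation.Nullary using (Dec; yes; no; contradiction)
open import Relation.Nullary.Decidable
  using (from-yes; map′; _→-dec_; _×-dec_; _⊎-dec_; ¬?; decidable-stable)

-- Candidate pairings: finite tables with periodic tails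

record Profile : Set where
  field
    {start pred-period} : ℕ
    initial : Vec ℕ start
    offsets : Vec ℤ (suc pred-period)

  at : ℕ → ℕ
  at x with x <? start
  ... | yes x<start = lookup initial (fromℕ< x<start)
  ... | no  _       = ∣ + x ℤ.+ lookup offsets ((x ∸ start) mod suc pred-period) ∣

open Profile

-- For `c ≤ 3` the tables stop at 56 = 7·2³, the first colour change, so that below 56 both colours
-- can share one table.
φ₀-initial : Vec ℕ 56
φ₀-initial =
   0 ∷  2 ∷  1 ∷  3 ∷  4 ∷  5 ∷  8 ∷  9 ∷  6 ∷  7 ∷
  12 ∷ 13 ∷ 10 ∷ 11 ∷ 14 ∷ 15 ∷ 16 ∷ 17 ∷ 18 ∷ 19 ∷
  20 ∷ 21 ∷ 22 ∷ 23 ∷ 24 ∷ 25 ∷ 26 ∷ 27 ∷ 30 ∷ 31 ∷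
  28 ∷ 29 ∷ 34 ∷ 35 ∷ 32 ∷ 33 ∷ 38 ∷ 39 ∷ 36 ∷ 37 ∷
  42 ∷ 43 ∷ 40 ∷ 41 ∷ 46 ∷ 47 ∷ 44 ∷ 45 ∷ 50 ∷ 51 ∷
  48 ∷ 49 ∷ 54 ∷ 55 ∷ 52 ∷ 53 ∷ []

φ₁-initial : Vec ℕ 56
φ₁-initial =
   2 ∷  3 ∷  0 ∷  1 ∷  5 ∷  4 ∷  9 ∷  8 ∷  7 ∷  6 ∷
  13 ∷ 12 ∷ 11 ∷ 10 ∷ 15 ∷ 14 ∷ 17 ∷ 16 ∷ 19 ∷ 18 ∷
  21 ∷ 20 ∷ 23 ∷ 22 ∷ 25 ∷ 24 ∷ 27 ∷ 26 ∷ 31 ∷ 30 ∷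
  29 ∷ 28 ∷ 35 ∷ 34 ∷ 33 ∷ 32 ∷ 39 ∷ 38 ∷ 37 ∷ 36 ∷
  43 ∷ 42 ∷ 41 ∷ 40 ∷ 47 ∷ 46 ∷ 45 ∷ 44 ∷ 51 ∷ 50 ∷
  49 ∷ 48 ∷ 55 ∷ 54 ∷ 53 ∷ 52 ∷ []

φ₂-initial : Vec ℕ 56
φ₂-initial =
   1 ∷  0 ∷  2 ∷  4 ∷  3 ∷  6 ∷  5 ∷  7 ∷  8 ∷  9 ∷
  10 ∷ 11 ∷ 12 ∷ 13 ∷ 18 ∷ 19 ∷ 20 ∷ 21 ∷ 14 ∷ 15 ∷
  16 ∷ 17 ∷ 26 ∷ 27 ∷ 28 ∷ 29 ∷ 22 ∷ 23 ∷ 24 ∷ 25 ∷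
  30 ∷ 31 ∷ 32 ∷ 33 ∷ 34 ∷ 35 ∷ 36 ∷ 37 ∷ 38 ∷ 39 ∷
  40 ∷ 41 ∷ 42 ∷ 43 ∷ 44 ∷ 45 ∷ 46 ∷ 47 ∷ 48 ∷ 49 ∷
  50 ∷ 51 ∷ 52 ∷ 53 ∷ 54 ∷ 55 ∷ []

φ₃-initial : Vec ℕ 56
φ₃-initial =
   3 ∷  1 ∷  4 ∷  0 ∷  2 ∷  7 ∷  6 ∷  5 ∷  9 ∷  8 ∷
  11 ∷ 10 ∷ 13 ∷ 12 ∷ 19 ∷ 18 ∷ 21 ∷ 20 ∷ 15 ∷ 14 ∷
  17 ∷ 16 ∷ 27 ∷ 26 ∷ 29 ∷ 28 ∷ 23 ∷ 22 ∷ 25 ∷ 24 ∷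
  31 ∷ 30 ∷ 33 ∷ 32 ∷ 35 ∷ 34 ∷ 37 ∷ 36 ∷ 39 ∷ 38 ∷
  41 ∷ 40 ∷ 43 ∷ 42 ∷ 45 ∷ 44 ∷ 47 ∷ 46 ∷ 49 ∷ 48 ∷
  51 ∷ 50 ∷ 53 ∷ 52 ∷ 55 ∷ 54 ∷ []

φ₄-initial : Vec ℕ 30
φ₄-initial =
   4 ∷  5 ∷  3 ∷  2 ∷  0 ∷  1 ∷  7 ∷  6 ∷ 10 ∷ 11 ∷
   8 ∷  9 ∷ 14 ∷ 15 ∷ 12 ∷ 13 ∷ 18 ∷ 19 ∷ 16 ∷ 17 ∷
  22 ∷ 23 ∷ 20 ∷ 21 ∷ 26 ∷ 27 ∷ 24 ∷ 25 ∷ 28 ∷ 29 ∷ []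

φ₅-initial : Vec ℕ 30
φ₅-initial =
   5 ∷  4 ∷  6 ∷  7 ∷  1 ∷  0 ∷  2 ∷  3 ∷ 11 ∷ 10 ∷
   9 ∷  8 ∷ 15 ∷ 14 ∷ 13 ∷ 12 ∷ 19 ∷ 18 ∷ 17 ∷ 16 ∷
  23 ∷ 22 ∷ 21 ∷ 20 ∷ 27 ∷ 26 ∷ 25 ∷ 24 ∷ 29 ∷ 28 ∷ []

φ₆-initial : Vec ℕ 30
φ₆-initial =
   8 ∷  9 ∷  5 ∷  6 ∷  7 ∷  2 ∷  3 ∷  4 ∷  0 ∷  1 ∷
  16 ∷ 17 ∷ 18 ∷ 19 ∷ 20 ∷ 21 ∷ 10 ∷ 11 ∷ 12 ∷ 13 ∷
  14 ∷ 15 ∷ 24 ∷ 25 ∷ 22 ∷ 23 ∷ 28 ∷ 29 ∷ 26 ∷ 27 ∷ []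

φ₇-initial : Vec ℕ 30
φ₇-initial =
   9 ∷  8 ∷  7 ∷  5 ∷  6 ∷  3 ∷  4 ∷  2 ∷  1 ∷  0 ∷
  17 ∷ 16 ∷ 19 ∷ 18 ∷ 21 ∷ 20 ∷ 11 ∷ 10 ∷ 13 ∷ 12 ∷
  15 ∷ 14 ∷ 25 ∷ 24 ∷ 23 ∷ 22 ∷ 29 ∷ 28 ∷ 27 ∷ 26 ∷ []

φ₈-initial : Vec ℕ 64
φ₈-initial =
   6 ∷  7 ∷  8 ∷  9 ∷ 10 ∷ 11 ∷  0 ∷  1 ∷  2 ∷  3 ∷
   4 ∷  5 ∷ 16 ∷ 17 ∷ 22 ∷ 23 ∷ 12 ∷ 13 ∷ 20 ∷ 21 ∷
  18 ∷ 19 ∷ 14 ∷ 15 ∷ 30 ∷ 31 ∷ 32 ∷ 33 ∷ 34 ∷ 35 ∷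
  24 ∷ 25 ∷ 26 ∷ 27 ∷ 28 ∷ 29 ∷ 40 ∷ 41 ∷ 44 ∷ 45 ∷
  36 ∷ 37 ∷ 48 ∷ 49 ∷ 38 ∷ 39 ∷ 52 ∷ 53 ∷ 42 ∷ 43 ∷
  56 ∷ 57 ∷ 46 ∷ 47 ∷ 60 ∷ 61 ∷ 50 ∷ 51 ∷ 62 ∷ 63 ∷
  54 ∷ 55 ∷ 58 ∷ 59 ∷ []

φ₉-initial : Vec ℕ 64
φ₉-initial =
   7 ∷  6 ∷  9 ∷  8 ∷ 11 ∷ 10 ∷  1 ∷  0 ∷  3 ∷  2 ∷
   5 ∷  4 ∷ 17 ∷ 16 ∷ 23 ∷ 22 ∷ 13 ∷ 12 ∷ 21 ∷ 20 ∷
  19 ∷ 18 ∷ 15 ∷ 14 ∷ 31 ∷ 30 ∷ 33 ∷ 32 ∷ 35 ∷ 34 ∷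
  25 ∷ 24 ∷ 27 ∷ 26 ∷ 29 ∷ 28 ∷ 41 ∷ 40 ∷ 45 ∷ 44 ∷
  37 ∷ 36 ∷ 49 ∷ 48 ∷ 39 ∷ 38 ∷ 53 ∷ 52 ∷ 43 ∷ 42 ∷
  57 ∷ 56 ∷ 47 ∷ 46 ∷ 61 ∷ 60 ∷ 51 ∷ 50 ∷ 63 ∷ 62 ∷
  55 ∷ 54 ∷ 59 ∷ 58 ∷ []

profile : ℕ → Bool → Profile
profile 0 false = record { initial = φ₀-initial ; offsets = + 0 ∷ + 0 ∷ + 0 ∷ + 0 ∷ [] }
profile 0 true  = record { initial = φ₀-initial ; offsets = + 2 ∷ + 2 ∷ - + 2 ∷ - + 2 ∷ [] }
profile 1 false = record { initial = φ₁-initial ; offsets = + 1 ∷ - + 1 ∷ + 1 ∷ - + 1 ∷ [] }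
profile 1 true  = record { initial = φ₁-initial ; offsets = + 3 ∷ + 1 ∷ - + 1 ∷ - + 3 ∷ [] }
profile 2 false = record { initial = φ₂-initial ; offsets = + 2 ∷ + 2 ∷ - + 2 ∷ - + 2 ∷ [] }
profile 2 true  = record { initial = φ₂-initial ; offsets = + 0 ∷ + 0 ∷ + 0 ∷ + 0 ∷ [] }
profile 3 false = record { initial = φ₃-initial ; offsets = + 3 ∷ + 1 ∷ - + 1 ∷ - + 3 ∷ [] }
profile 3 true  = record { initial = φ₃-initial ; offsets = + 1 ∷ - + 1 ∷ + 1 ∷ - + 1 ∷ [] }
profile 4 _     = record { initial = φ₄-initial ; offsets = + 2 ∷ + 2 ∷ - + 2 ∷ - + 2 ∷ [] }
profile 5 _     = record { initial = φ₅-initial ; offsets = + 3 ∷ + 1 ∷ - + 1 ∷ - + 3 ∷ [] }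
profile 6 _     = record
  { initial = φ₆-initial
  ; offsets =
      + 4 ∷ + 4 ∷ + 4 ∷ + 4 ∷
      - + 4 ∷ - + 4 ∷ - + 4 ∷ - + 4 ∷ []
  }
profile 7 _     = record
  { initial = φ₇-initial
  ; offsets =
      + 5 ∷ + 3 ∷ + 5 ∷ + 3 ∷
      - + 3 ∷ - + 5 ∷ - + 3 ∷ - + 5 ∷ []
  }
profile 8 _     = record
  { initial = φ₈-initial
  ; offsets =
      + 6 ∷ + 6 ∷ + 6 ∷ + 6 ∷ + 6 ∷ + 6 ∷
      - + 6 ∷ - + 6 ∷ - + 6 ∷ - + 6 ∷ - + 6 ∷ - + 6 ∷ []
  }
profile 9 _     = record
  { initial = φ₉-initial
  ; offsets =
      + 7 ∷ + 5 ∷ + 7 ∷ + 5 ∷ + 7 ∷ + 5 ∷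
      - + 5 ∷ - + 7 ∷ - + 5 ∷ - + 7 ∷ - + 5 ∷ - + 7 ∷ []
  }
-- For c = 10; larger c do not occur.
profile _ _     = record { initial = φ₁₀-initial ; offsets = S₁₀ }

pairing : ℕ → Bool → ℕ → ℕ
pairing c β = at (profile c β)

-- Decidable local conditions

∀Bool? : {P : Bool → Set} → (∀ β → Dec (P β)) → Dec (∀ β → P β)
∀Bool? P? = map′ (λ { (f , t) false → f ; (f , t) true → t })
                 (λ f → f false , f true)
                 (P? false ×-dec P? true)

-- a / 4; written with ⌊_/2⌋ so that block (48 + a) computes to 12 + block a and
-- block ⌊ a /2⌋ to ⌊ block a /2⌋.
block : ℕ → ℕ
block a = ⌊ ⌊ a /2⌋ /2⌋

-- The colour is constant on blocks; this is all that a check at a needs to know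
-- about the colour of a nearby b, which may differ across a boundary 7·2ᵏ.
Compatible : ℕ → Bool → ℕ → Bool → Set
Compatible a β b β′ = block a ≡ block b → β ≡ β′

compatible? : ∀ a β b β′ → Dec (Compatible a β b β′)
compatible? a β b β′ = (block a ≟ block b) →-dec (β Bool.≟ β′)

-- In these conditions β is the colour of a, so that not β is that of ⌊ a /2⌋.
Near NoDrop NoHalving Involutive Covering : ℕ → Bool → ℕ → Set

Near c β a = pairing c β a ≤ 12 + a × a ≤ 12 + pairing c β a

NoDrop c β a = ∀ {c′} → c′ < c → pairing c′ β a ≢ pairing c β a

NoHalving c β a = 0 < a + c →
  pairing ⌊ c /2⌋ (not β) ⌊ a /2⌋ ≢ ⌊ pairing c β a /2⌋

Involutive c β a = ∀ β′ → Compatible a β (pairing c β a) β′ →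
  pairing c β′ (pairing c β a) ≡ a

-- If b < Φ c a and a < Φ c b, lowering a or b alone reaches no 𝒫-position, so a
-- winning move must lower c or halve.
Covered : ℕ → Bool → ℕ → ℕ → Set
Covered c β a b = (∃ λ c′ → c′ < c × pairing c′ β a ≡ b) ⊎
                  pairing ⌊ c /2⌋ (not β) ⌊ a /2⌋ ≡ ⌊ b /2⌋

CoveringAt : ℕ → Bool → ℕ → ℕ → Set
CoveringAt c β a b = b < pairing c β a →
  ∀ β′ → Compatible a β b β′ → a < pairing c β′ b → Covered c β a b

-- Under `Near` at `a` and at `b`, the inequalities in `CoveringAt` put `b` strictly between
-- `a - 12` and `a + 12`. For `a < 12` truncation merely starts the window at 0.
Covering c β a = ∀ {j} → j < 24 → CoveringAt c β a (a ∸ 12 + j)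

Local : ℕ → Bool → ℕ → Set
Local c β a = Near c β a × NoDrop c β a × NoHalving c β a ×
              Involutive c β a × Covering c β a

local? : ∀ c β a → Dec (Local c β a)
local? c β a =
  ((_ ≤? _) ×-dec (_ ≤? _)) ×-dec
  allUpTo? (λ _ → ¬? (_ ≟ _)) c ×-dec
  ((_ <? _) →-dec ¬? (_ ≟ _)) ×-dec
  ∀Bool? (λ β′ → compatible? _ _ _ β′ →-dec (_ ≟ _)) ×-dec
  allUpTo? (λ j → (_ <? _) →-dec ∀Bool? λ β′ →
    compatible? _ _ _ β′ →-dec ((_ <? _) →-dec
      (anyUpTo? (λ _ → _ ≟ _) c ⊎-dec (_ ≟ _)))) 24

-- `fold true not` computes a parity. Since `⌊log₂ 0 ⌋` is 0, the colour is `true` on all of [0,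
-- 56).
colour : ℕ → Bool
colour a = fold true not ⌊log₂ block a / 7 ⌋

local-initial : ∀ {c} → c < 11 → ∀ {a} → a < 112 → Local c (colour a) a
local-initial = from-yes (allUpTo? (λ c → allUpTo? (λ a → local? c (colour a) a) 112) 11)

-- From 112 on, both `a` and `⌊ a /2⌋` lie past the tables for `c ≤ 3`, so `β` can be left free. The
-- length 68 reaches 132 = 112 + 20, where shifting becomes available, and one period of 48 beyond.
local-window : ∀ {c} → c < 11 → ∀ β {i} → i < 68 → Local c β (112 + i)
local-window = from-yes
  (allUpTo? (λ c → ∀Bool? λ β → allUpTo? (λ i → local? c β (112 + i)) 68) 11)

-- Invariance under shifting by a period

shift-offset : ∀ k {a} s → ∣ s ∣ ≤ a → ∣ + (k + a) ℤ.+ s ∣ ≡ k + ∣ + a ℤ.+ s ∣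
shift-offset k {a} (+ n)    _   = +-assoc k a n
shift-offset k {a} -[1+ n ] n<a = begin
  ∣ (k + a) ℤ.⊖ suc n ∣ ≡⟨ cong ∣_∣ (⊖-≥ (≤-trans n<a (m≤n+m a k))) ⟩
  k + a ∸ suc n         ≡⟨ +-∸-assoc k n<a ⟩
  k + (a ∸ suc n)       ≡⟨ cong (λ x → k + ∣ x ∣) (⊖-≥ n<a) ⟨
  k + ∣ a ℤ.⊖ suc n ∣   ∎
  where open ≡-Reasoning

-- Offsets at least -n keep the integer sum in Profile.at nonnegative beyond n.
PeriodicFrom : ℕ → ℕ → Profile → Set
PeriodicFrom n k p = start p ≤ n × suc (pred-period p) ∣ k ×
                     (∀ i → ∣ lookup (offsets p) i ∣ ≤ n)

periodicFrom? : ∀ n k p → Dec (PeriodicFrom n k p)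
periodicFrom? n k p =
  (_ ≤? _) ×-dec (_ ∣? _) ×-dec Fin.all? (λ _ → _ ≤? _)

-- Past `n` both arguments fall in the periodic branch and, the period dividing `k`, meet the same
-- offset.
at-shift : ∀ {n k} p → PeriodicFrom n k p → ∀ {a} → n ≤ a →
           at p (k + a) ≡ k + at p a
at-shift {n} {k} p (s≤n , divides q refl , small) {a} n≤a
  with k + a <? start p | a <? start p
... | yes k+a<s | _       =
  contradiction k+a<s (≤⇒≯ (≤-trans s≤n (≤-trans n≤a (m≤n+m a k))))
... | no _      | yes a<s = contradiction a<s (≤⇒≯ (≤-trans s≤n n≤a))
... | no _      | no _    = begin
  ∣ + (k + a) ℤ.+ offset (k + a) ∣
    ≡⟨ cong (λ i → ∣ + (k + a) ℤ.+ lookup (offsets p) i ∣) same-residue ⟩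
  ∣ + (k + a) ℤ.+ offset a ∣
    ≡⟨ shift-offset k (offset a) (≤-trans (small _) n≤a) ⟩
  k + ∣ + a ℤ.+ offset a ∣ ∎
  where
  open ≡-Reasoning
  offset : ℕ → ℤ
  offset x = lookup (offsets p) ((x ∸ start p) mod suc (pred-period p))
  same-residue : (k + a ∸ start p) mod suc (pred-period p) ≡
                 (a ∸ start p) mod suc (pred-period p)
  same-residue = fromℕ<-cong _ _
    (begin
      (k + a ∸ start p) % suc (pred-period p)
        ≡⟨ cong (_% suc (pred-period p)) (+-∸-assoc k (≤-trans s≤n n≤a)) ⟩
      (k + (a ∸ start p)) % suc (pred-period p)
        ≡⟨ %-remove-+ˡ (a ∸ start p) (divides q refl) ⟩
      (a ∸ start p) % suc (pred-period p) ∎)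
    _ _

pairing-shift : ∀ {c} → c < 11 → ∀ β {a} → 66 ≤ a →
                pairing c β (48 + a) ≡ 48 + pairing c β a
pairing-shift c<11 β = at-shift _ (periodic c<11 β)
  where
  periodic : ∀ {c} → c < 11 → ∀ β → PeriodicFrom 66 48 (profile c β)
  -- 66 is the greatest table length, and 48 is a common multiple of the periods 4, 8, 12 and 48.
  periodic = from-yes (allUpTo? (λ c → ∀Bool? λ β → periodicFrom? 66 48 (profile c β)) 11)

half-bound : ∀ {c} → c < 11 → ⌊ c /2⌋ < 6
half-bound (s≤s c≤10) = s≤s (⌊n/2⌋-mono c≤10)

-- Halving turns a shift by 48 into one by 24, still a multiple of the period 4 of every profile
-- with `c ≤ 5`. The bound 132 = 2·66 keeps `⌊ a /2⌋` past the tables.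
pairing-shift-half : ∀ {c} → c < 11 → ∀ β {a} → 132 ≤ a →
  pairing ⌊ c /2⌋ β ⌊ 48 + a /2⌋ ≡ 24 + pairing ⌊ c /2⌋ β ⌊ a /2⌋
pairing-shift-half c<11 β 132≤a =
  at-shift _ (periodic (half-bound c<11) β) (⌊n/2⌋-mono 132≤a)
  where
  periodic : ∀ {c} → c < 6 → ∀ β → PeriodicFrom 66 24 (profile c β)
  periodic = from-yes (allUpTo? (λ c → ∀Bool? λ β → periodicFrom? 66 24 (profile c β)) 6)

module _ {c : ℕ} {β : Bool} {a : ℕ} (c<11 : c < 11) (132≤a : 132 ≤ a) where

  private
    66≤a : 66 ≤ a
    66≤a = ≤-trans (m≤m+n 66 66) 132≤a

    shift : pairing c β (48 + a) ≡ 48 + pairing c β a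
    shift = pairing-shift c<11 β 66≤a

  near-shift : Near c β a → Near c β (48 + a)
  near-shift (b≤ , a≤) =
    ≤-trans (≤-reflexive shift) (+-monoʳ-≤ 48 b≤) ,
    ≤-trans (+-monoʳ-≤ 48 a≤) (+-monoʳ-≤ 12 (≤-reflexive (sym shift)))

  noDrop-shift : NoDrop c β a → NoDrop c β (48 + a)
  noDrop-shift noDrop c′<c eq = noDrop c′<c (+-cancelˡ-≡ 48 _ _
    (trans (sym (pairing-shift (<-trans c′<c c<11) β 66≤a)) (trans eq shift)))

  noHalving-shift : NoHalving c β a → NoHalving c β (48 + a)
  noHalving-shift noHalving _ eq =
    noHalving (≤-trans (≤-trans (s≤s z≤n) 132≤a) (m≤m+n a c))
      (+-cancelˡ-≡ 24 _ _
        (trans (sym (pairing-shift-half c<11 (not β) 132≤a))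
               (trans eq (cong ⌊_/2⌋ shift))))

  -- The partner of `a` is at least `a - 12`, hence also past 66, and shifts along. Both blocks grow
  -- by 12, so their equality is unaffected.
  involutive-shift : Near c β a → Involutive c β a → Involutive c β (48 + a)
  involutive-shift (_ , a≤) inv rewrite shift = λ β′ compat →
    trans (pairing-shift c<11 β′ 66≤b)
          (cong (_+_ 48) (inv β′ (λ eq → compat (cong (_+_ 12) eq))))
    where
    66≤b : 66 ≤ pairing c β a
    66≤b = +-cancelˡ-≤ 12 66 _ (≤-trans (≤-trans (m≤m+n 78 54) 132≤a) a≤)

  covered-shift : ∀ {b} → Covered c β a b → Covered c β (48 + a) (48 + b)
  covered-shift (inj₁ (c′ , c′<c , eq)) = inj₁
    (c′ , c′<c , trans (pairing-shift (<-trans c′<c c<11) β 66≤a) (cong (_+_ 48) eq))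
  covered-shift (inj₂ eq) = inj₂
    (trans (pairing-shift-half c<11 (not β) 132≤a) (cong (_+_ 24) eq))

  coveringAt-shift : ∀ {b} → 66 ≤ b → CoveringAt c β a b → CoveringAt c β (48 + a) (48 + b)
  coveringAt-shift 66≤b covering b< β′ compat a< = covered-shift
    (covering (+-cancelˡ-< 48 _ _ (≤-trans b< (≤-reflexive shift))) β′
      (λ eq → compat (cong (_+_ 12) eq))
      (+-cancelˡ-< 48 _ _ (≤-trans a< (≤-reflexive (pairing-shift c<11 β′ 66≤b)))))

  covering-shift : Covering c β a → Covering c β (48 + a)
  covering-shift covering {j} j<24 =
    -- As `12≤a` excludes truncation, the window moves by exactly 48.
    subst (CoveringAt c β (48 + a)) (cong (_+ j) (sym (+-∸-assoc 48 12≤a)))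
      (coveringAt-shift 66≤b (covering j<24))
    where
    12≤a : 12 ≤ a
    12≤a = ≤-trans (m≤m+n 12 120) 132≤a
    66≤b : 66 ≤ a ∸ 12 + j
    66≤b = ≤-trans (∸-monoˡ-≤ 12 (≤-trans (m≤m+n 78 54) 132≤a)) (m≤m+n (a ∸ 12) j)

  local-shift : Local c β a → Local c β (48 + a)
  local-shift (near , noDrop , noHalving , inv , covering) =
    near-shift near , noDrop-shift noDrop , noHalving-shift noHalving ,
    involutive-shift near inv , covering-shift covering

local-tail : ∀ {c} → c < 11 → ∀ β i → Local c β (112 + i)
local-tail {c} c<11 β = <-rec _ step
  where
  step : ∀ i → (∀ {j} → j < i → Local c β (112 + j)) → Local c β (112 + i)
  step i rec with i <? 68
  ... | yes i<68 = local-window c<11 β i<68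
  ... | no  i≮68 = subst (Local c β) 48+[112+j]≡112+i
                     (local-shift c<11 (+-monoʳ-≤ 112 20≤j) (rec j<i))
    where
    j = i ∸ 48
    48+j≡i : 48 + j ≡ i
    48+j≡i = m+[n∸m]≡n (≤-trans (m≤m+n 48 20) (≮⇒≥ i≮68))
    20≤j : 20 ≤ j
    20≤j = ∸-monoˡ-≤ 48 (≮⇒≥ i≮68)
    j<i : j < i
    -- `47 + suc j` computes to `48 + j`.
    j<i = subst (j <_) 48+j≡i (m≤n+m (suc j) 47)
    48+[112+j]≡112+i : 48 + (112 + j) ≡ 112 + i
    48+[112+j]≡112+i = cong (_+_ 112) 48+j≡i

local : ∀ {c} → c < 11 → ∀ a → Local c (colour a) a
local c<11 a with a <? 112
... | yes a<112 = local-initial c<11 a<112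
... | no  a≮112 = subst (λ x → Local _ (colour a) x) (m+[n∸m]≡n (≮⇒≥ a≮112))
                    (local-tail c<11 (colour a) (a ∸ 112))

-- Halving negates the colour

n/2≡⌊n/2⌋ : ∀ n → n / 2 ≡ ⌊ n /2⌋
n/2≡⌊n/2⌋ zero          = refl
n/2≡⌊n/2⌋ (suc zero)    = refl
n/2≡⌊n/2⌋ (suc (suc n)) =
  trans (m/n≡1+[m∸n]/n (m≤m+n 2 n)) (cong suc (n/2≡⌊n/2⌋ n))

-- Both sides are the floor of `n` divided by `2 * m`.
⌊n/2⌋/m≡⌊n/m/2⌋ : ∀ n m .{{_ : NonZero m}} → ⌊ n /2⌋ / m ≡ ⌊ n / m /2⌋
⌊n/2⌋/m≡⌊n/m/2⌋ n m = begin
  ⌊ n /2⌋ / m ≡⟨ cong (_/ m) (n/2≡⌊n/2⌋ n) ⟨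
  n / 2 / m   ≡⟨ m/n/o≡m/o/n n ⟩
  n / m / 2   ≡⟨ n/2≡⌊n/2⌋ (n / m) ⟩
  ⌊ n / m /2⌋ ∎
  where
  open ≡-Reasoning
  m/n/o≡m/o/n : ∀ n → n / 2 / m ≡ n / m / 2
  m/n/o≡m/o/n n = trans (m/n/o≡m/[n*o] n 2 m)
    (trans (/-congʳ (*-comm 2 m)) (sym (m/n/o≡m/[n*o] n m 2)))
    where instance _ = m*n≢0 2 m
                   _ = m*n≢0 m 2

-- From 56 on `block a / 7` is at least 2, so its logarithm is positive and halving lowers it by
-- exactly one.
colour-half : ∀ {a} → 56 ≤ a → colour ⌊ a /2⌋ ≡ not (colour a)
colour-half {a} 56≤a = begin
  fold true not ⌊log₂ ⌊ block a /2⌋ / 7 ⌋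
    ≡⟨ cong (λ x → fold true not ⌊log₂ x ⌋) (⌊n/2⌋/m≡⌊n/m/2⌋ (block a) 7) ⟩
  fold true not ⌊log₂ ⌊ block a / 7 /2⌋ ⌋
    ≡⟨ cong (fold true not) (⌊log₂⌊n/2⌋⌋≡⌊log₂n⌋∸1 (block a / 7)) ⟩
  fold true not (⌊log₂ block a / 7 ⌋ ∸ 1)
    ≡⟨ alternate (⌊log₂⌋-mono-≤ (/-monoˡ-≤ 7 (⌊n/2⌋-mono (⌊n/2⌋-mono 56≤a)))) ⟩
  not (colour a) ∎
  where
  open ≡-Reasoning
  alternate : ∀ {n} → 1 ≤ n → fold true not (n ∸ 1) ≡ not (fold true not n)
  alternate {suc n} _ = sym (not-involutive (fold true not n))

-- Termination: every move loses coins

sum-remove : ∀ ps (i : Fin (length ps)) {m} → m < List.lookup ps i →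
             sum (ps [ i ]∷= m) < sum ps
sum-remove (p ∷ ps) Fin.zero    m<p = +-monoˡ-< (sum ps) m<p
sum-remove (p ∷ ps) (Fin.suc i) m<p = +-monoʳ-< p (sum-remove ps i m<p)

sum-halve-≤ : ∀ ps → sum (List.map ⌊_/2⌋ ps) ≤ sum ps
sum-halve-≤ []       = z≤n
sum-halve-≤ (p ∷ ps) = +-mono-≤ (⌊n/2⌋≤n p) (sum-halve-≤ ps)

sum-halve-< : ∀ {ps} → Any (0 <_) ps → sum (List.map ⌊_/2⌋ ps) < sum ps
sum-halve-< {suc p ∷ ps} (here _)  = +-mono-<-≤ (⌊n/2⌋<n p) (sum-halve-≤ ps)
sum-halve-< {p ∷ ps}     (there x) = +-mono-≤-< (⌊n/2⌋≤n p) (sum-halve-< x)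

⟶-sum : ∀ {ps qs} → ps ⟶ qs → sum qs < sum ps
⟶-sum {ps} (remove i m<p) = sum-remove ps i m<p
⟶-sum      (halve x)      = sum-halve-< x

-- From a pairing to winning strategies

module Pairing
  {n : ℕ} (Φ : ℕ → ℕ → ℕ) (Φ00≡0 : Φ 0 0 ≡ 0)
  (Φ-involutive : ∀ {c} → c < n → ∀ a → Φ c (Φ c a) ≡ a)
  (Φ-noDrop : ∀ {c} → c < n → ∀ {c′} a → c′ < c → Φ c′ a ≢ Φ c a)
  (Φ-noHalving : ∀ {c} → c < n → ∀ a → 0 < a + c →
    ⌊ Φ c a /2⌋ ≢ Φ ⌊ c /2⌋ ⌊ a /2⌋)
  (Φ-covering : ∀ {c} → c < n → ∀ a b → b < Φ c a → a < Φ c b →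
    (∃ λ c′ → c′ < c × b ≡ Φ c′ a) ⊎ ⌊ b /2⌋ ≡ Φ ⌊ c /2⌋ ⌊ a /2⌋)
  where

  -- A coin in the second pile alone would give `0 < Φ 0 0`.
  some-coin : ∀ a c → Any (0 <_) (a ∷ Φ c a ∷ c ∷ []) → 0 < a + c
  some-coin zero    zero    (there (here 0<Φ00)) = ⊥-elim (n≮0 (subst (0 <_) Φ00≡0 0<Φ00))
  some-coin zero    zero    (there (there (here ())))
  some-coin zero    (suc _) _ = z<s
  some-coin (suc _) _       _ = z<s

  can-halve : ∀ a b c → b < Φ c a → Any (0 <_) (a ∷ b ∷ c ∷ [])
  can-halve (suc _) _ _       _ = here z<s
  can-halve zero    _ (suc _) _ = there (there (here z<s))
  can-halve zero    _ zero    b<Φ00 = ⊥-elim (n≮0 (subst (_ <_) Φ00≡0 b<Φ00))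

  𝒫-on-Φ : ∀ {a b c} → c < n → Acc _<_ (sum (a ∷ b ∷ c ∷ [])) →
           b ≡ Φ c a → 𝒫-position (a ∷ b ∷ c ∷ [])
  𝒩-off-Φ : ∀ {a b c} → c < n → Acc _<_ (sum (a ∷ b ∷ c ∷ [])) →
            b ≢ Φ c a → 𝒩-position (a ∷ b ∷ c ∷ [])

  𝒫-on-Φ {a} {_} {c} c<n (acc rec) refl = reply λ where
    p@(remove Fin.zero {a′} a′<a) → 𝒩-off-Φ c<n (rec (⟶-sum p)) λ eq →
      -- An involution is injective, so a smaller first pile has a different partner.
      <⇒≢ a′<a (trans (sym (Φ-involutive c<n a′))
                      (trans (cong (Φ c) (sym eq)) (Φ-involutive c<n a)))
    p@(remove (Fin.suc Fin.zero) b′<b) → 𝒩-off-Φ c<n (rec (⟶-sum p)) (<⇒≢ b′<b)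
    p@(remove (Fin.suc (Fin.suc Fin.zero)) c′<c) →
      𝒩-off-Φ (<-trans c′<c c<n) (rec (⟶-sum p)) λ eq → Φ-noDrop c<n a c′<c (sym eq)
    p@(halve x) → 𝒩-off-Φ (≤-<-trans (⌊n/2⌋≤n c) c<n) (rec (⟶-sum p))
      (Φ-noHalving c<n a (some-coin a c x))

  𝒩-off-Φ {a} {b} {c} c<n (acc rec) b≢ with <-cmp b (Φ c a)
  ... | tri≈ _ b≡ _ = contradiction b≡ b≢
  ... | tri> _ _ b> = let p = remove (Fin.suc Fin.zero) b> in
    move p (𝒫-on-Φ c<n (rec (⟶-sum p)) refl)
  -- The second pile is already below `Φ c a`; the next candidate is lowering the first pile to
  -- `Φ c b`.
  ... | tri< b< _ _ with <-cmp (Φ c b) a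
  ...   | tri≈ _ refl _ = contradiction (sym (Φ-involutive c<n b)) b≢
  ...   | tri< a> _ _ = let p = remove Fin.zero a> in
    move p (𝒫-on-Φ c<n (rec (⟶-sum p)) (sym (Φ-involutive c<n b)))
  ...   | tri> _ _ a< with Φ-covering c<n a b b< a<
  ...     | inj₁ (c′ , c′<c , eq) = let p = remove (Fin.suc (Fin.suc Fin.zero)) c′<c in
    move p (𝒫-on-Φ (<-trans c′<c c<n) (rec (⟶-sum p)) eq)
  ...     | inj₂ eq = let p = halve (can-halve a b c b<) in
    move p (𝒫-on-Φ (≤-<-trans (⌊n/2⌋≤n c) c<n) (rec (⟶-sum p)) eq)

-- The coloured pairing satisfies the requirements

Φ : ℕ → ℕ → ℕ
Φ c a = pairing c (colour a) a

colour-compatible : ∀ a b → Compatible a (colour a) b (colour b)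
colour-compatible _ _ = cong (λ q → fold true not ⌊log₂ q / 7 ⌋)

Φ-near : ∀ {c} → c < 11 → ∀ a → Φ c a ≤ 12 + a
Φ-near c<11 a = let (b≤ , _) , _ = local c<11 a in b≤

Φ-noDrop : ∀ {c} → c < 11 → ∀ {c′} a → c′ < c → Φ c′ a ≢ Φ c a
Φ-noDrop c<11 a = let _ , noDrop , _ = local c<11 a in noDrop

Φ-involutive : ∀ {c} → c < 11 → ∀ a → Φ c (Φ c a) ≡ a
Φ-involutive {c} c<11 a = let _ , _ , _ , inv , _ = local c<11 a in
  inv (colour (Φ c a)) (colour-compatible a (Φ c a))

-- `colour-half` needs `56 ≤ a`; below that `⌊ a /2⌋` lies in the tables, where both colours give
-- the same values.
Φ-half : ∀ {c} → c < 11 → ∀ a →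
         Φ ⌊ c /2⌋ ⌊ a /2⌋ ≡ pairing ⌊ c /2⌋ (not (colour a)) ⌊ a /2⌋
Φ-half {c} c<11 a with a <? 56
... | no  a≮56 = cong (λ β → pairing ⌊ c /2⌋ β ⌊ a /2⌋) (colour-half (≮⇒≥ a≮56))
... | yes a<56 = trans (colourless (colour ⌊ a /2⌋)) (sym (colourless (not (colour a))))
  where
  agree : ∀ {c} → c < 6 → ∀ {a} → a < 56 → pairing c true a ≡ pairing c false a
  agree = from-yes (allUpTo? (λ c →
    allUpTo? (λ a → pairing c true a ≟ pairing c false a) 56) 6)
  colourless : ∀ β → pairing ⌊ c /2⌋ β ⌊ a /2⌋ ≡ pairing ⌊ c /2⌋ false ⌊ a /2⌋
  colourless false = refl
  colourless true  = agree (half-bound c<11) (≤-<-trans (⌊n/2⌋≤n a) a<56)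

Φ-noHalving : ∀ {c} → c < 11 → ∀ a → 0 < a + c →
              ⌊ Φ c a /2⌋ ≢ Φ ⌊ c /2⌋ ⌊ a /2⌋
Φ-noHalving c<11 a 0<a+c eq = let _ , _ , noHalving , _ = local c<11 a in
  noHalving 0<a+c (trans (sym (Φ-half c<11 a)) (sym eq))

-- `Φ-near` at `a` and at `b` confines `b` to the window of `Covering`, and the true colours of `a`
-- and `b` are always compatible.
Φ-covering : ∀ {c} → c < 11 → ∀ a b → b < Φ c a → a < Φ c b →
             (∃ λ c′ → c′ < c × b ≡ Φ c′ a) ⊎ ⌊ b /2⌋ ≡ Φ ⌊ c /2⌋ ⌊ a /2⌋
Φ-covering {c} c<11 a b b< a< = conclude
  (subst (CoveringAt c (colour a) a) a∸12+j≡b (covering j<24) b<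
    (colour b) (colour-compatible a b) a<)
  where
  covering : Covering c (colour a) a
  covering = let _ , _ , _ , _ , covering = local c<11 a in covering
  a≤12+b : a ≤ 12 + b
  a≤12+b = <⇒≤ (<-≤-trans a< (Φ-near c<11 b))
  a∸12≤b : a ∸ 12 ≤ b
  a∸12≤b = m≤n+o⇒m∸n≤o a 12 a≤12+b
  j = b ∸ (a ∸ 12)
  a∸12+j≡b : a ∸ 12 + j ≡ b
  a∸12+j≡b = m+[n∸m]≡n a∸12≤b
  j<24 : j < 24
  j<24 = +-cancelˡ-< (a ∸ 12) j 24 (begin-strict
    a ∸ 12 + j    ≡⟨ a∸12+j≡b ⟩
    b             <⟨ b< ⟩
    Φ c a         ≤⟨ Φ-near c<11 a ⟩
    12 + a        ≤⟨ +-monoʳ-≤ 12 (m≤n+m∸n a 12) ⟩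
    24 + (a ∸ 12) ≡⟨ +-comm 24 (a ∸ 12) ⟩
    a ∸ 12 + 24   ∎)
    where open ≤-Reasoning
  conclude : Covered c (colour a) a b → _
  conclude (inj₁ (c′ , c′<c , eq)) = inj₁ (c′ , c′<c , sym eq)
  conclude (inj₂ eq)               = inj₂ (sym (trans (Φ-half c<11 a) eq))

𝒫∧𝒩⇒⊥ : ∀ {p} → 𝒫-position p → 𝒩-position p → ⊥
𝒫∧𝒩⇒⊥ (reply r) (move p⟶q 𝒫q) = 𝒫∧𝒩⇒⊥ 𝒫q (r p⟶q)

Φ-10 : ∀ a → Φ 10 a ≡ φ₁₀ a
Φ-10 a with a <? 66
... | yes _ = refl
... | no  _ = refl

theorem42 : (a b : ℕ) → 𝒫-position (a ∷ b ∷ 10 ∷ []) ⇔ b ≡ φ₁₀ a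
theorem42 a b rewrite sym (Φ-10 a) = mk⇔ to (𝒫-on-Φ 10<11 (<-wellFounded _))
  where
  open Pairing Φ refl Φ-involutive Φ-noDrop Φ-noHalving Φ-covering
  10<11 : 10 < 11
  10<11 = n<1+n 10
  to : 𝒫-position (a ∷ b ∷ 10 ∷ []) → b ≡ Φ 10 a
  -- Otherwise the position would belong to both classes.
  to 𝒫ab = decidable-stable (b ≟ Φ 10 a)
    λ b≢ → 𝒫∧𝒩⇒⊥ 𝒫ab (𝒩-off-Φ 10<11 (<-wellFounded _) b≢)
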